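{- Let $n\ge1$ and $0\le k\le n-1$ be integers. For any permutation $\sigma\in S_n$, $$\sum_{p\in\varphi_k^{ -1}(\sigma)} q^{\mathtt{area}_k(p)}=\prod_{i=1}^n [\ell_k(i;\sigma)]_q.$$
   Context: Write $[n]=\{1,\dots,n\}$. A street has parking spots $1,\dots,n$ in order, and cars $c_1,\dots,c_n$ arrive in this order. A parking preference is a tuple $\alpha=(a_1,\dots,a_n)\in[n]^n$, where $a_i$ is the preferred spot of $c_i$. $k$-Naples parking rule: car $c_i$ drives to spot $a_i$; if it is empty, $c_i$ parks there. If it is occupied, $c_i$ backs up one spot at a time, checking spots $a_i-1,a_i-2,\dots$ in turn, up to at most $k$ spots behind $a_i$ (and never past spot $1$), and parks in the first empty one it finds. If all of these spots are occupied, $c_i$ goes forward and parks in the first empty spot after $a_i$, if there is one; otherwise it fails to park. The preference $\alpha$ is a $k$-Naples parking function of length $n$ if all $n$ cars park under this rule; $PF_{n,k}$ is the set of all of these. $S_n$ is the symmetric group on $[n]$, with permutations in one-line notation. The map $\varphi_k:PF_{n,k}\to S_n$ sends $\alpha$ to $s_1s_2\cdots s_n$, where spot $i$ is occupied by car $c_{s_i}$ after all cars have parked under the $k$-Naples rule. $\varphi_k^{ -1}(\sigma)\subseteq PF_{n,k}$ denotes the fiber. For $\sigma=s_1\cdots s_n\in S_n$ and $1\le i\le n$ (subsequences here are blocks of consecutive entries): - $\mathtt{left}_k(i;\sigma)$ is the length of the longest subsequence $s_j\cdots s_{i-1}$ such that $s_t<s_i$ for all $j\le t<i$ (equal to $0$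 if it is empty). - $\mathtt{right}_k(i;\sigma)$ is the length of the longest subsequence $s_i\cdots s_r$ such that $r\le i+k$ (and $r\le n$) and $s_t\le s_i$ for all $i\le t\le r$. - $\ell_k(i;\sigma)=\mathtt{left}_k(i;\sigma)+\mathtt{right}_k(i;\sigma)$ if $\mathtt{left}_k(i;\sigma)=i-1$, and $\ell_k(i;\sigma)=\max(\mathtt{left}_k(i;\sigma)-k,0)+\mathtt{right}_k(i;\sigma)$ if $\mathtt{left}_k(i;\sigma)<i-1$. The $k$-Naples area of $\alpha=(a_1,\dots,a_n)\in PF_{n,k}$ is $$\mathtt{area}_k(\alpha)=\sum_{i=1}^n\left[n-i+\mathtt{right}_k(i;\varphi_k(\alpha))-a_i\right].$$ For a positive integer $m$, $[m]_q=1+q+\cdots+q^{m-1}$, where $q$ is an indeterminate. -}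

module Defs where

open import Data.Bool.Base using (if_then_else_)
open import Data.Fin.Base using (Fin; zero; suc; toℕ; inject₁; punchOut; _≤_; _<_)
open import Data.Fin.Permutation as Perm using (Permutation′; permutation; _⟨$⟩ʳ_)
open import Data.Fin.Properties
  using (_≟_; _≤?_; _<?_; all?; any?; injective⇒≤; punchOut-injective)
open import Data.Integer.Base as ℤ using (ℤ; +_; 0ℤ; 1ℤ)
import Data.Integer.Properties as ℤₚ
open import Data.List.Base
  using (List; []; _∷_; _++_; map; filter; foldr; findᵇ; allFin; upTo; mapMaybe;
         cartesianProductWith)
open import Data.List.Extrema.Nat using (max)
open import Data.List.Membership.Propositional using (_∈_)
open import Data.List.Membership.Propositional.Properties using (∈-allFin)
open import Data.List.Relation.Unary.Any using (here; there)
open import Data.Maybe.Base as Maybe using (Maybe; just; nothing; is-nothing; _>>=_)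
open import Data.Maybe using (Is-just; to-witness)
open import Data.Maybe.Properties using (just-injective)
import Data.Maybe.Relation.Unary.Any as MaybeAny
open import Data.Nat.Base as ℕ using (ℕ; zero; suc; _∸_)
import Data.Nat.Properties as ℕₚ
open import Data.Product.Base using (Σ; ∃; _×_; _,_; proj₁; proj₂)
open import Data.Unit.Base using (tt)
open import Data.Vec.Base using (Vec; []; _∷_; lookup; replicate; _[_]≔_)
open import Data.Vec.Properties using (lookup-replicate; lookup∘update; lookup∘update′)
import Data.Vec.Functional as Vector
open import Function.Base using (_∘_; case_of_)
open import Relation.Binary.PropositionalEquality
  using (_≡_; _≢_; refl; sym; trans; cong)
open import Relation.Nullary
  using (Dec; yes; no; does; contradiction; _×-dec_; _→-dec_)
open import Relation.Nullary.Decidable using (dec⇒maybe)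

open import Algebra.Properties.CommutativeMonoid.Sum ℤₚ.+-0-commutativeMonoid
  using (sum)

-- Cars, spots and the entries of a preference are numbered from 0 (elements
-- of Fin n), so the one-based number of x : Fin n is suc (toℕ x).

one-based : ∀ {n} → Fin n → ℕ
one-based x = suc (toℕ x)

Preference : ℕ → Set
Preference n = Vec (Fin n) n

------------------------------------------------------------------------
-- The k-Naples parking rule

Street : ℕ → Set
Street n = Vec (Maybe (Fin n)) n

backward : ∀ {n} → ℕ → Fin n → List (Fin n)
backward zero    a       = []
backward (suc k) zero    = []
backward (suc k) (suc a) = inject₁ a ∷ backward k (inject₁ a)

forward : ∀ {n} → Fin n → List (Fin n)
forward {n} a = filter (a <?_) (allFin n)

-- A car preferring a parks in the first empty spot of this list.
searchOrder : ∀ {n} → ℕ → Fin n → List (Fin n)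
searchOrder k a = a ∷ backward k a ++ forward a

firstEmpty : ∀ {n} → Street n → List (Fin n) → Maybe (Fin n)
firstEmpty st = findᵇ (λ s → is-nothing (lookup st s))

parkCar : ∀ {n} → ℕ → Preference n → Fin n → Street n → Maybe (Street n)
parkCar k α c st =
  Maybe.map (λ s → st [ s ]≔ just c) (firstEmpty st (searchOrder k (lookup α c)))

-- The result is nothing as soon as some car fails to park.
parkCars : ∀ {n} → ℕ → Preference n → List (Fin n) → Street n → Maybe (Street n)
parkCars k α []       st = just st
parkCars k α (c ∷ cs) st = parkCar k α c st >>= parkCars k α cs

outcome : ∀ {n} → ℕ → Preference n → Maybe (Street n)
outcome {n} k α = parkCars k α (allFin n) (replicate n nothing)

IsNaples : ∀ {n} → ℕ → Preference n → Set
IsNaples k α = Is-just (outcome k α)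

isNaples? : ∀ {n} k (α : Preference n) → Dec (IsNaples k α)
isNaples? k α = MaybeAny.dec (λ _ → yes tt) (outcome k α)

PF : ℕ → ℕ → Set
PF n k = Σ (Preference n) (IsNaples k)

finalStreet : ∀ {n k} → PF n k → Street n
finalStreet (_ , parked) = to-witness parked

------------------------------------------------------------------------
-- Once all cars have parked, every spot holds exactly one car

firstEmpty-empty : ∀ {n} (st : Street n) xs {s} →
                   firstEmpty st xs ≡ just s → lookup st s ≡ nothing
firstEmpty-empty st (x ∷ xs) eq with lookup st x in lx
... | nothing = trans (cong (lookup st) (sym (just-injective eq))) lx
... | just _  = firstEmpty-empty st xs eq

parkCar-spec : ∀ {n} k (α : Preference n) c st {st′} → parkCar k α c st ≡ just st′ →
               ∃ λ s → lookup st s ≡ nothing × st′ ≡ st [ s ]≔ just c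
parkCar-spec k α c st eq with firstEmpty st (searchOrder k (lookup α c)) in fe
parkCar-spec k α c st refl | just s =
  s , firstEmpty-empty st (searchOrder k (lookup α c)) fe , refl

parkCar-keeps : ∀ {n} k (α : Preference n) c st {st′} → parkCar k α c st ≡ just st′ →
                ∀ {s d} → lookup st s ≡ just d → lookup st′ s ≡ just d
parkCar-keeps k α c st eq {s} occ with parkCar-spec k α c st eq
... | s₀ , empty , refl with s ≟ s₀
...   | yes refl = case trans (sym empty) occ of λ ()
...   | no s≢s₀  = trans (lookup∘update′ s≢s₀ st (just c)) occ

parkCars-keeps : ∀ {n} k (α : Preference n) cs st {st′} → parkCars k α cs st ≡ just st′ →
                 ∀ {s d} → lookup st s ≡ just d → lookup st′ s ≡ just d
parkCars-keeps k α []       st refl occ = occ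
parkCars-keeps k α (c ∷ cs) st eq   occ with parkCar k α c st in pc
... | just st₁ = parkCars-keeps k α cs st₁ eq (parkCar-keeps k α c st pc occ)

parkCars-parks : ∀ {n} k (α : Preference n) cs st {st′} → parkCars k α cs st ≡ just st′ →
                 ∀ {d} → d ∈ cs → ∃ λ s → lookup st′ s ≡ just d
parkCars-parks k α (c ∷ cs) st eq d∈ with parkCar k α c st in pc
parkCars-parks k α (c ∷ cs) st eq (there d∈) | just st₁ =
  parkCars-parks k α cs st₁ eq d∈
parkCars-parks k α (c ∷ cs) st eq (here refl) | just st₁
  with parkCar-spec k α c st pc
... | s , _ , refl =
  s , parkCars-keeps k α cs st₁ eq (lookup∘update s st (just c))

finalStreet-outcome : ∀ {n k} (p : PF n k) → outcome k (proj₁ p) ≡ just (finalStreet p)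
finalStreet-outcome {k = k} (α , parked) with outcome k α | parked
... | just _ | MaybeAny.just _ = refl

parked-somewhere : ∀ {n k} (p : PF n k) c → ∃ λ s → lookup (finalStreet p) s ≡ just c
parked-somewhere {n} {k} p c =
  parkCars-parks k (proj₁ p) (allFin n) (replicate n nothing)
    (finalStreet-outcome p) (∈-allFin c)

spotOf : ∀ {n k} → PF n k → Fin n → Fin n
spotOf p c = proj₁ (parked-somewhere p c)

spotOf-occupied : ∀ {n k} (p : PF n k) c → lookup (finalStreet p) (spotOf p c) ≡ just c
spotOf-occupied p c = proj₂ (parked-somewhere p c)

spotOf-injective : ∀ {n k} (p : PF n k) {c d} → spotOf p c ≡ spotOf p d → c ≡ d
spotOf-injective p {c} {d} eq = just-injective
  (trans (sym (spotOf-occupied p c))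
         (trans (cong (lookup (finalStreet p)) eq) (spotOf-occupied p d)))

injective⇒preimage : ∀ {n} (f : Fin n → Fin n) → (∀ {x y} → f x ≡ f y → x ≡ y) →
                     ∀ y → ∃ λ x → f x ≡ y
injective⇒preimage {suc n} f inj y with any? (λ x → f x ≟ y)
... | yes found = found
... | no  none  = contradiction (injective⇒≤ g-injective) ℕₚ.1+n≰n
  where
  y≢f : ∀ x → y ≢ f x
  y≢f x y≡fx = none (x , sym y≡fx)

  g : Fin (suc n) → Fin n
  g x = punchOut (y≢f x)

  g-injective : ∀ {x x′} → g x ≡ g x′ → x ≡ x′
  g-injective {x} {x′} eq = inj (punchOut-injective (y≢f x) (y≢f x′) eq)

full : ∀ {n k} (p : PF n k) s → ∃ λ c → lookup (finalStreet p) s ≡ just c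
full p s with injective⇒preimage (spotOf p) (spotOf-injective p) s
... | c , refl = c , spotOf-occupied p c

carAt : ∀ {n k} → PF n k → Fin n → Fin n
carAt p s = proj₁ (full p s)

carAt-occupies : ∀ {n k} (p : PF n k) s → lookup (finalStreet p) s ≡ just (carAt p s)
carAt-occupies p s = proj₂ (full p s)

carAt-spotOf : ∀ {n k} (p : PF n k) c → carAt p (spotOf p c) ≡ c
carAt-spotOf p c =
  just-injective (trans (sym (carAt-occupies p (spotOf p c))) (spotOf-occupied p c))

spotOf-carAt : ∀ {n k} (p : PF n k) s → spotOf p (carAt p s) ≡ s
spotOf-carAt p s with injective⇒preimage (spotOf p) (spotOf-injective p) s
... | c , refl = refl

-- The permutation σ has one-line notation s₁ ⋯ sₙ with sᵢ = σ ⟨$⟩ʳ i.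
φ : ∀ {n} k → PF n k → Permutation′ n
φ k p = permutation (carAt p) (spotOf p) (carAt-spotOf p) (spotOf-carAt p)

------------------------------------------------------------------------
-- Enumeration of the fibers of φ

allVecs : ∀ {A : Set} → List A → ∀ m → List (Vec A m)
allVecs xs zero    = [] ∷ []
allVecs xs (suc m) = cartesianProductWith _∷_ xs (allVecs xs m)

allPreferences : ∀ n → List (Preference n)
allPreferences n = allVecs (allFin n) n

allPF : ∀ n k → List (PF n k)
allPF n k =
  mapMaybe (λ α → Maybe.map (α ,_) (dec⇒maybe (isNaples? k α))) (allPreferences n)

_≈?_ : ∀ {n} (π ρ : Permutation′ n) → Dec (π Perm.≈ ρ)
π ≈? ρ = all? (λ i → (π ⟨$⟩ʳ i) ≟ (ρ ⟨$⟩ʳ i))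

fiber : ∀ {n} k → Permutation′ n → List (PF n k)
fiber {n} k σ = filter (λ p → φ k p ≈? σ) (allPF n k)

------------------------------------------------------------------------
-- Statistics on permutations

-- The block s_j ⋯ s_{i-1}, empty for j = i, has length i ∸ j.
LeftBlock : ∀ {n} → Permutation′ n → Fin n → Fin n → Set
LeftBlock σ i j = j ≤ i × (∀ t → j ≤ t → t < i → (σ ⟨$⟩ʳ t) < (σ ⟨$⟩ʳ i))

leftBlock? : ∀ {n} (σ : Permutation′ n) i j → Dec (LeftBlock σ i j)
leftBlock? σ i j =
  (j ≤? i) ×-dec
  all? (λ t → (j ≤? t) →-dec ((t <? i) →-dec ((σ ⟨$⟩ʳ t) <? (σ ⟨$⟩ʳ i))))

-- No dependence on k.
left : ∀ {n} → Permutation′ n → Fin n → ℕ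
left {n} σ i = max 0 (map (λ j → toℕ i ∸ toℕ j) (filter (leftBlock? σ i) (allFin n)))

RightBlock : ∀ {n} → ℕ → Permutation′ n → Fin n → Fin n → Set
RightBlock k σ i r =
  i ≤ r × toℕ r ℕ.≤ toℕ i ℕ.+ k ×
  (∀ t → i ≤ t → t ≤ r → (σ ⟨$⟩ʳ t) ≤ (σ ⟨$⟩ʳ i))

rightBlock? : ∀ {n} k (σ : Permutation′ n) i r → Dec (RightBlock k σ i r)
rightBlock? k σ i r =
  (i ≤? r) ×-dec (toℕ r ℕₚ.≤? toℕ i ℕ.+ k) ×-dec
  all? (λ t → (i ≤? t) →-dec ((t ≤? r) →-dec ((σ ⟨$⟩ʳ t) ≤? (σ ⟨$⟩ʳ i))))

right : ∀ {n} → ℕ → Permutation′ n → Fin n → ℕ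
right {n} k σ i =
  max 0 (map (λ r → suc (toℕ r) ∸ toℕ i) (filter (rightBlock? k σ i) (allFin n)))

-- With spots counted from 0, the condition left = i - 1 reads left = toℕ i,
-- and max(left - k, 0) is truncated subtraction.
ℓ : ∀ {n} → ℕ → Permutation′ n → Fin n → ℕ
ℓ k σ i =
  if does (left σ i ℕₚ.≟ toℕ i)
  then left σ i ℕ.+ right k σ i
  else (left σ i ∸ k) ℕ.+ right k σ i

area : ∀ {n} k → PF n k → ℤ
area {n} k p@(α , _) = sum λ i →
  + n ℤ.- + one-based i ℤ.+ + right k (φ k p) i ℤ.- + one-based (lookup α i)

------------------------------------------------------------------------
-- Laurent polynomials in q over ℤ; the exponent area is by definition an
-- integer

-- A formal sum of terms (coefficient , exponent), repeated exponents allowed.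
Laurent : Set
Laurent = List (ℤ × ℤ)

coeff : Laurent → ℤ → ℤ
coeff []            e = 0ℤ
coeff ((c , d) ∷ f) e = (if does (d ℤₚ.≟ e) then c else 0ℤ) ℤ.+ coeff f e

infix 4 _≋_
_≋_ : Laurent → Laurent → Set
f ≋ g = ∀ e → coeff f e ≡ coeff g e

0ᴸ 1ᴸ : Laurent
0ᴸ = []
1ᴸ = (1ℤ , 0ℤ) ∷ []

infixl 6 _+ᴸ_
_+ᴸ_ : Laurent → Laurent → Laurent
_+ᴸ_ = _++_

infixl 7 _*ᴸ_
_*ᴸ_ : Laurent → Laurent → Laurent
_*ᴸ_ = cartesianProductWith λ (c , d) (c′ , d′) → c ℤ.* c′ , d ℤ.+ d′

q^_ : ℤ → Laurent
q^ e = (1ℤ , e) ∷ []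

∑ : ∀ {A : Set} → List A → (A → Laurent) → Laurent
∑ xs f = foldr _+ᴸ_ 0ᴸ (map f xs)

∏ : ∀ {n} → (Fin n → Laurent) → Laurent
∏ = Vector.foldr _*ᴸ_ 1ᴸ

[_]q : ℕ → Laurent
[ m ]q = ∑ (upTo m) λ j → q^ (+ j)

{-# OPTIONS --safe #-}

-- On the way to σ, the spots occupied when car σᵢ arrives are those t with σₜ < σᵢ, so
-- whether it stops at spot i depends on its own preference a only: it does exactly when a
-- lies in a window of ℓ(i) consecutive spots ending at i + right(i) - 1.  The fiber over σ
-- is thus a product of windows.  As Σ (n - i) = Σ (i - 1), the area is, after reindexing the
-- cars by their spots, the sum of the distances of the preferences from the right ends of
-- their windows, so the generating function factors.

module Submission where

open import Defs
open import Algebra.Bundles using (CommutativeMonoid)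
open import Data.Bool.Base using (Bool; true; false; if_then_else_)
open import Data.Fin.Base as Fin using (Fin; zero; suc; toℕ; inject₁; fromℕ<; opposite)
open import Data.Fin.Permutation using (Permutation′; _⟨$⟩ʳ_; _⟨$⟩ˡ_; inverseˡ; inverseʳ)
import Data.Fin.Permutation as Perm
open import Data.Fin.Properties as Finₚ
  using (toℕ-injective; toℕ<n; toℕ-fromℕ<; toℕ-inject₁; opposite-prop; ¬∀⟶∃¬)
open import Data.Integer.Base as ℤ using (ℤ; +_; 0ℤ; 1ℤ)
import Data.Integer.Properties as ℤₚ
open import Data.List.Base
  using (List; []; _∷_; _++_; map; filter; foldr; findᵇ; allFin; upTo; tabulate; mapMaybe;
         cartesianProductWith)
open import Data.List.Extrema.Nat using (max; v≤max⁺; argmax-sel)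
open import Data.List.Membership.Propositional using (_∈_)
open import Data.List.Membership.Propositional.Properties
  using (∈-map⁺; ∈-map⁻; ∈-filter⁺; ∈-filter⁻; ∈-allFin; ∈-upTo⁺; ∈-upTo⁻)
open import Data.List.Membership.Propositional.Properties.WithK using (unique∧set⇒bag)
open import Data.List.Properties
  using (++-assoc; ++-identityʳ; map-++; map-∘; map-cong; map-id; filter-≐;
         cartesianProductWith-zeroʳ; cartesianProductWith-distribʳ-++)
open import Data.List.Relation.Binary.BagAndSetEquality using (∼bag⇒↭)
open import Data.List.Relation.Binary.Permutation.Propositional as ↭
  using (_↭_; ↭-refl; ↭-sym; ↭-trans; ↭-reflexive; module PermutationReasoning)
open import Data.List.Relation.Binary.Permutation.Propositional.Properties
  using (shifts) renaming (map⁺ to ↭-map⁺; ++⁺ to ↭-++⁺; ++⁺ˡ to ↭-++⁺ˡ)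
import Data.List.Relation.Unary.Any as Any
import Data.List.Relation.Unary.Unique.Propositional.Properties as Uniqueₚ
open import Data.Maybe.Base as Maybe
  using (Maybe; just; nothing; maybe′; is-nothing; _<∣>_; _>>=_)
open import Data.Maybe using (Is-just)
open import Data.Maybe.Properties using (just-injective)
import Data.Maybe.Relation.Unary.Any as MaybeAny
open import Data.Nat.Base as ℕ using (ℕ; zero; suc; _+_; _∸_; _≤_; _<_; z≤n; s≤s)
open import Data.Nat.Properties
open import Data.Product.Base using (∃; _×_; _,_; proj₁; proj₂)
open import Data.Sum.Base using (_⊎_; inj₁; inj₂)
open import Data.Unit.Base using (tt)
open import Data.Vec.Base using (_∷_; lookup; replicate; _[_]≔_)
open import Data.Vec.Properties using (lookup∘update; lookup∘update′; lookup-replicate)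
open import Function.Base using (_∘_; flip; id)
open import Function.Bundles using (mk⇔)
open import Level using (0ℓ)
open import Relation.Binary.Definitions using (tri<; tri≈; tri>)
open import Relation.Binary.PropositionalEquality
open import Relation.Nullary
  using (Dec; yes; no; does; ¬_; contradiction; _×-dec_)
open import Relation.Nullary.Decidable using (dec⇒maybe)
open import Relation.Unary using (Pred; Decidable)

open import Algebra.Properties.AbelianGroup ℤₚ.+-0-abelianGroup
  using () renaming (∙-cancelˡ to ℤ-+-cancelˡ)
open import Algebra.Properties.CommutativeMonoid.Sum ℤₚ.+-0-commutativeMonoid
  using (sum; sum-cong-≗; sum-permute; ∑-distrib-+)

-- Laurent polynomials up to reordering of terms

-- The shape of the windows, and with it the case distinction in `ℓ`, comes from the two ways to
-- reach spot `i`. With a preference `a` at or after `i`, the car stops at `i` when `a` is at most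
-- `k` spots away and the spots after `i` up to `a` are taken, which is a right block. With `a`
-- before `i`, it first fails to find room behind `a`, so all spots from `a - k` to `i - 1` must be
-- taken: the left block of `i` has to start at `a - k` or earlier, which leaves `left - k` choices.
-- If the left block starts at the first spot of the street, the car has nowhere further to back up,
-- and all `left` choices count. That a preference in the fiber respects all windows needs the
-- intermediate streets; they can be read off from the final one because a parked car never moves.

module _ {A B C : Set} (f : A → B → C) where

  private _⊗_ = cartesianProductWith f

  ⊗-congˡ : ∀ xs {ys zs} → ys ↭ zs → xs ⊗ ys ↭ xs ⊗ zs
  ⊗-congˡ []       p = ↭-refl
  ⊗-congˡ (x ∷ xs) p = ↭-++⁺ (↭-map⁺ (f x) p) (⊗-congˡ xs p)

  -- The product is listed row by row, and the terms with factor `y` head the rows; `shifts` moves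
  -- each of them ahead of the remainders of the earlier rows.
  ⊗-∷ʳ : ∀ xs y ys → xs ⊗ (y ∷ ys) ↭ map (λ x → f x y) xs ++ xs ⊗ ys
  ⊗-∷ʳ []       y ys = ↭-refl
  ⊗-∷ʳ (x ∷ xs) y ys = ↭.prep _
    (↭-trans (↭-++⁺ˡ (map (f x) ys) (⊗-∷ʳ xs y ys))
             (shifts (map (f x) ys) (map (λ x → f x y) xs)))

⊗-comm : ∀ {A B C : Set} (f : A → B → C) xs ys →
         cartesianProductWith f xs ys ↭ cartesianProductWith (flip f) ys xs
⊗-comm f xs []       = ↭-reflexive (cartesianProductWith-zeroʳ f xs)
⊗-comm f xs (y ∷ ys) = ↭-trans (⊗-∷ʳ f xs y ys) (↭-++⁺ˡ _ (⊗-comm f xs ys))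

⊗-cong-≗ : ∀ {A B C : Set} {f g : A → B → C} → (∀ x y → f x y ≡ g x y) → ∀ xs ys →
           cartesianProductWith f xs ys ≡ cartesianProductWith g xs ys
⊗-cong-≗ f≗g []       ys = refl
⊗-cong-≗ f≗g (x ∷ xs) ys = cong₂ _++_ (map-cong (f≗g x) ys) (⊗-cong-≗ f≗g xs ys)

*ᴸ-comm : ∀ f g → f *ᴸ g ↭ g *ᴸ f
*ᴸ-comm f g = ↭-trans (⊗-comm _ f g) (↭-reflexive
  (⊗-cong-≗ (λ (c , d) (c′ , d′) → cong₂ _,_ (ℤₚ.*-comm c′ c) (ℤₚ.+-comm d′ d)) g f))

-- Only the right factor can be reordered row by row, so commutativity brings the left factor to
-- that side. `*ᴸ-distribˡ` is reduced to `*ᴸ-distribʳ` in the same way.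
*ᴸ-cong : ∀ {f f′ g g′} → f ↭ f′ → g ↭ g′ → f *ᴸ g ↭ f′ *ᴸ g′
*ᴸ-cong {f} {f′} {g} {g′} p q = begin
  f *ᴸ g    ↭⟨ *ᴸ-comm f g ⟩
  g *ᴸ f    ↭⟨ ⊗-congˡ _ g p ⟩
  g *ᴸ f′   ↭⟨ *ᴸ-comm g f′ ⟩
  f′ *ᴸ g   ↭⟨ ⊗-congˡ _ f′ q ⟩
  f′ *ᴸ g′  ∎
  where open PermutationReasoning

*ᴸ-distribʳ : ∀ f g h → (f +ᴸ g) *ᴸ h ≡ f *ᴸ h +ᴸ g *ᴸ h
*ᴸ-distribʳ = cartesianProductWith-distribʳ-++ _

*ᴸ-distribˡ : ∀ f g h → f *ᴸ (g +ᴸ h) ↭ f *ᴸ g +ᴸ f *ᴸ h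
*ᴸ-distribˡ f g h = begin
  f *ᴸ (g +ᴸ h)     ↭⟨ *ᴸ-comm f (g +ᴸ h) ⟩
  (g +ᴸ h) *ᴸ f     ≡⟨ *ᴸ-distribʳ g h f ⟩
  g *ᴸ f +ᴸ h *ᴸ f  ↭⟨ ↭-++⁺ (*ᴸ-comm g f) (*ᴸ-comm h f) ⟩
  f *ᴸ g +ᴸ f *ᴸ h  ∎
  where open PermutationReasoning

*ᴸ-zeroʳ : ∀ f → f *ᴸ 0ᴸ ≡ 0ᴸ
*ᴸ-zeroʳ = cartesianProductWith-zeroʳ _

*ᴸ-assoc : ∀ f g h → (f *ᴸ g) *ᴸ h ≡ f *ᴸ (g *ᴸ h)
*ᴸ-assoc []      g h = refl
*ᴸ-assoc (t@(a , b) ∷ f) g h = trans (*ᴸ-distribʳ (map (t ·_) g) (f *ᴸ g) h)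
                             (cong₂ _++_ (map-*ᴸ g) (*ᴸ-assoc f g h))
  where
  _·_ : ℤ × ℤ → ℤ × ℤ → ℤ × ℤ
  (c , d) · (c′ , d′) = c ℤ.* c′ , d ℤ.+ d′

  map-*ᴸ : ∀ g → map (t ·_) g *ᴸ h ≡ map (t ·_) (g *ᴸ h)
  map-*ᴸ []                  = refl
  map-*ᴸ (u@(c′ , d′) ∷ g) = begin
    map ((t · u) ·_) h ++ map (t ·_) g *ᴸ h
      ≡⟨ cong₂ _++_ (map-cong (λ (c″ , d″) → cong₂ _,_ (ℤₚ.*-assoc a c′ c″) (ℤₚ.+-assoc b d′ d″)) h)
                    (map-*ᴸ g) ⟩
    map ((t ·_) ∘ (u ·_)) h ++ map (t ·_) (g *ᴸ h)
      ≡⟨ cong (_++ _) (map-∘ h) ⟩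
    map (t ·_) (map (u ·_) h) ++ map (t ·_) (g *ᴸ h)
      ≡⟨ map-++ (t ·_) (map (u ·_) h) (g *ᴸ h) ⟨
    map (t ·_) (map (u ·_) h ++ g *ᴸ h) ∎
    where open ≡-Reasoning

*ᴸ-identityˡ : ∀ f → 1ᴸ *ᴸ f ≡ f
*ᴸ-identityˡ f = trans (++-identityʳ _) (trans
  (map-cong (λ (c , d) → cong₂ _,_ (ℤₚ.*-identityˡ c) (ℤₚ.+-identityˡ d)) f) (map-id f))

-- The finite sums of this monoid are the products `∏`, so reindexing a product along a permutation
-- is an instance of a library lemma.
*ᴸ-commutativeMonoid : CommutativeMonoid 0ℓ 0ℓ
*ᴸ-commutativeMonoid = record
  { Carrier = Laurent ; _≈_ = _↭_ ; _∙_ = _*ᴸ_ ; ε = 1ᴸ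
  ; isCommutativeMonoid = record
    { isMonoid = record
      { isSemigroup = record
        { isMagma = record { isEquivalence = ↭.↭-isEquivalence ; ∙-cong = *ᴸ-cong }
        ; assoc = λ f g h → ↭-reflexive (*ᴸ-assoc f g h) }
      ; identity = (λ f → ↭-reflexive (*ᴸ-identityˡ f))
                 , (λ f → ↭-trans (*ᴸ-comm f 1ᴸ) (↭-reflexive (*ᴸ-identityˡ f))) }
    ; comm = *ᴸ-comm } }

open import Algebra.Properties.CommutativeMonoid.Sum *ᴸ-commutativeMonoid
  using () renaming (sum-permute to ∏-permute; sum-cong-≋ to ∏-cong)

-- Reordering is a finer relation than equality of coefficients. It suffices here because every term
-- that occurs has coefficient 1 and nothing cancels.
↭⇒≋ : ∀ {f g} → f ↭ g → f ≋ g
↭⇒≋ ↭.refl                     e = refl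
↭⇒≋ (↭.prep (c , d) p)         e = cong (ℤ._+_ (if does (d ℤₚ.≟ e) then c else 0ℤ)) (↭⇒≋ p e)
↭⇒≋ (↭.swap (c , d) (c′ , d′) p) e =
  trans (cong (λ z → x ℤ.+ (y ℤ.+ z)) (↭⇒≋ p e))
        (trans (sym (ℤₚ.+-assoc x y _))
               (trans (cong (ℤ._+ _) (ℤₚ.+-comm x y)) (ℤₚ.+-assoc y x _)))
  where
  x = if does (d ℤₚ.≟ e) then c else 0ℤ
  y = if does (d′ ℤₚ.≟ e) then c′ else 0ℤ
↭⇒≋ (↭.trans p q)              e = trans (↭⇒≋ p e) (↭⇒≋ q e)

-- Sums of Laurent polynomials and the distributive law

∑-++ : ∀ {A : Set} xs ys (F : A → Laurent) → ∑ (xs ++ ys) F ≡ ∑ xs F +ᴸ ∑ ys F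
∑-++ []       ys F = refl
∑-++ (x ∷ xs) ys F = trans (cong (F x ++_) (∑-++ xs ys F)) (sym (++-assoc (F x) _ _))

∑-map : ∀ {A B : Set} (g : A → B) xs (F : B → Laurent) → ∑ (map g xs) F ≡ ∑ xs (F ∘ g)
∑-map g []       F = refl
∑-map g (x ∷ xs) F = cong (F (g x) ++_) (∑-map g xs F)

∑-distribˡ : ∀ {A : Set} f xs (F : A → Laurent) → ∑ xs (λ x → f *ᴸ F x) ↭ f *ᴸ ∑ xs F
∑-distribˡ f []       F = ↭-reflexive (sym (*ᴸ-zeroʳ f))
∑-distribˡ f (x ∷ xs) F =
  ↭-trans (↭-++⁺ˡ (f *ᴸ F x) (∑-distribˡ f xs F)) (↭-sym (*ᴸ-distribˡ f (F x) (∑ xs F)))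

-- Expanding a product of sums means choosing one summand from each factor, and such a choice is a
-- vector. This is what makes the generating function of a product of windows factor.
∑-∏ : ∀ {A : Set} (xs : List A) m (w : Fin m → A → Laurent) →
      ∑ (allVecs xs m) (λ v → ∏ (λ c → w c (lookup v c))) ↭ ∏ (λ c → ∑ xs (w c))
∑-∏ xs zero    w = ↭-refl
∑-∏ xs (suc m) w = ↭-trans (split xs) (⊗-congˡ _ (∑ xs (w zero)) (∑-∏ xs m (w ∘ suc)))
  where
  vs = allVecs xs m
  G  = λ v → ∏ (λ c → w (suc c) (lookup v c))
  F  = λ v → ∏ (λ c → w c (lookup v c))

  split : ∀ xs → ∑ (cartesianProductWith _∷_ xs vs) F ↭ ∑ xs (w zero) *ᴸ ∑ vs G
  split []       = ↭-refl
  split (x ∷ xs) = begin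
    ∑ (map (x ∷_) vs ++ cartesianProductWith _∷_ xs vs) F
      ≡⟨ ∑-++ (map (x ∷_) vs) _ F ⟩
    ∑ (map (x ∷_) vs) F +ᴸ ∑ (cartesianProductWith _∷_ xs vs) F
      ≡⟨ cong (_+ᴸ _) (∑-map (x ∷_) vs F) ⟩
    ∑ vs (λ v → w zero x *ᴸ G v) +ᴸ ∑ (cartesianProductWith _∷_ xs vs) F
      ↭⟨ ↭-++⁺ (∑-distribˡ (w zero x) vs G) (split xs) ⟩
    w zero x *ᴸ ∑ vs G +ᴸ ∑ xs (w zero) *ᴸ ∑ vs G
      ≡⟨ *ᴸ-distribʳ (w zero x) (∑ xs (w zero)) (∑ vs G) ⟨
    (w zero x +ᴸ ∑ xs (w zero)) *ᴸ ∑ vs G ∎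
    where open PermutationReasoning

-- The blocks of σ and the windows

⟨$⟩ʳ-injective : ∀ {n} (σ : Permutation′ n) {s t} → σ ⟨$⟩ʳ s ≡ σ ⟨$⟩ʳ t → s ≡ t
⟨$⟩ʳ-injective σ eq = trans (sym (inverseˡ σ)) (trans (cong (σ ⟨$⟩ˡ_) eq) (inverseˡ σ))

m∸n≤o⇒m≤n+o : ∀ m n {o} → m ∸ n ≤ o → m ≤ n + o
m∸n≤o⇒m≤n+o m n le = ≤-trans (m≤n+m∸n m n) (+-monoʳ-≤ n le)

module _ {A : Set} {P : Pred A 0ℓ} (P? : Decidable P) (v : A → ℕ) (xs : List A) where

  ≤max-filter : ∀ {x} → x ∈ xs → P x → v x ≤ max 0 (map v (filter P? xs))
  ≤max-filter x∈ px = v≤max⁺ 0 _ (inj₂ (Any.map ≤-reflexive (∈-map⁺ v (∈-filter⁺ P? x∈ px))))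

  max-filter-attained : max 0 (map v (filter P? xs)) ≡ 0 ⊎
                        (∃ λ x → P x × max 0 (map v (filter P? xs)) ≡ v x)
  max-filter-attained with argmax-sel id 0 (map v (filter P? xs))
  ... | inj₁ eq = inj₁ eq
  ... | inj₂ m∈ with ∈-map⁻ v m∈
  ...   | x , x∈ , eq = inj₂ (x , proj₂ (∈-filter⁻ P? {xs = xs} x∈) , eq)

module _ {n} (σ : Permutation′ n) (i : Fin n) where

  left-attained : left σ i ≡ 0 ⊎ (∃ λ j → LeftBlock σ i j × left σ i ≡ toℕ i ∸ toℕ j)
  left-attained = max-filter-attained (leftBlock? σ i) (λ j → toℕ i ∸ toℕ j) (allFin n)

  left≤ : left σ i ≤ toℕ i
  left≤ with left-attained
  ... | inj₁ eq           = subst (_≤ toℕ i) (sym eq) z≤n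
  ... | inj₂ (j , _ , eq) = subst (_≤ toℕ i) (sym eq) (m∸n≤m (toℕ i) (toℕ j))

  leftBlock⇒≤ : ∀ {j} → LeftBlock σ i j → toℕ i ≤ toℕ j + left σ i
  leftBlock⇒≤ {j} b =
    m∸n≤o⇒m≤n+o (toℕ i) (toℕ j) (≤max-filter (leftBlock? σ i) _ (allFin n) (∈-allFin j) b)

  -- A left block stays one when its start moves right, so every start from the extremal `j₀` on is
  -- valid. The bound is written additively to avoid truncated subtraction.
  ≤⇒leftBlock : ∀ {j} → toℕ j ≤ toℕ i → toℕ i ≤ toℕ j + left σ i → LeftBlock σ i j
  ≤⇒leftBlock {j} j≤i i≤ with left-attained
  ... | inj₁ eq = j≤i , λ t j≤t t<i →
        contradiction (≤-trans i≤ (≤-trans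
          (≤-reflexive (trans (cong (toℕ j ℕ.+_) eq) (+-identityʳ _))) j≤t))
                      (<⇒≱ t<i)
  ... | inj₂ (j₀ , (j₀≤i , b) , eq) = j≤i , λ t j≤t → b t (≤-trans j₀≤j j≤t)
    where
    j₀≤j : toℕ j₀ ≤ toℕ j
    j₀≤j = ∸-cancelʳ-≤ {toℕ j₀} {toℕ j} {toℕ i} j₀≤i
             (m≤n+o⇒m∸n≤o (toℕ i) (toℕ j) (subst (λ l → toℕ i ≤ toℕ j + l) eq i≤))

  module _ (k : ℕ) where

    right-attained : right k σ i ≡ 0 ⊎
                     (∃ λ r → RightBlock k σ i r × right k σ i ≡ suc (toℕ r) ∸ toℕ i)
    right-attained =
      max-filter-attained (rightBlock? k σ i) (λ r → suc (toℕ r) ∸ toℕ i) (allFin n)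

    rightBlock⇒< : ∀ {r} → RightBlock k σ i r → toℕ r < toℕ i + right k σ i
    rightBlock⇒< {r} b = m∸n≤o⇒m≤n+o (suc (toℕ r)) (toℕ i)
      (≤max-filter (rightBlock? k σ i) _ (allFin n) (∈-allFin r) b)

    -- Keeps the right end of the window on the street, so that every exponent is realised by an
    -- actual preference.
    i+right≤n : toℕ i + right k σ i ≤ n
    i+right≤n with right-attained
    ... | inj₁ eq = ≤-trans
          (≤-reflexive (trans (cong (toℕ i ℕ.+_) eq) (+-identityʳ _))) (<⇒≤ (toℕ<n i))
    ... | inj₂ (r , (i≤r , _) , eq) = ≤-trans
          (≤-reflexive (trans (cong (toℕ i ℕ.+_) eq) (m+[n∸m]≡n (m≤n⇒m≤1+n i≤r)))) (toℕ<n r)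

    <⇒rightBlock : ∀ {r} → toℕ i ≤ toℕ r → toℕ r < toℕ i + right k σ i → RightBlock k σ i r
    <⇒rightBlock {r} i≤r r< with right-attained
    ... | inj₁ eq = contradiction
          (≤-trans r< (≤-trans (≤-reflexive (trans (cong (toℕ i ℕ.+_) eq) (+-identityʳ _))) i≤r))
          (n≮n _)
    ... | inj₂ (r₀ , (i≤r₀ , r₀≤i+k , b) , eq) =
          i≤r , ≤-trans r≤r₀ r₀≤i+k , λ t i≤t t≤r → b t i≤t (≤-trans t≤r r≤r₀)
      where
      r≤r₀ : toℕ r ≤ toℕ r₀
      r≤r₀ = ≤-pred (≤-trans r<
        (≤-reflexive (trans (cong (toℕ i ℕ.+_) eq) (m+[n∸m]≡n (m≤n⇒m≤1+n i≤r₀)))))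

-- The number of preferences before spot `i` in its window; the other summand of `ℓ` counts those
-- from `i` on.
reach : ∀ {n} → ℕ → Permutation′ n → Fin n → ℕ
reach k σ i = if does (left σ i ≟ toℕ i) then left σ i else left σ i ∸ k

if-cases : ∀ {P A : Set} (P? : Dec P) (x y : A) →
           (P × (if does P? then x else y) ≡ x) ⊎ (¬ P × (if does P? then x else y) ≡ y)
if-cases (yes p) x y = inj₁ (p , refl)
if-cases (no ¬p) x y = inj₂ (¬p , refl)

reach-cases : ∀ {n} k (σ : Permutation′ n) i →
              (left σ i ≡ toℕ i × reach k σ i ≡ left σ i) ⊎
              (left σ i ≢ toℕ i × reach k σ i ≡ left σ i ∸ k)
reach-cases k σ i = if-cases (left σ i ≟ toℕ i) (left σ i) (left σ i ∸ k)

ℓ-reach : ∀ {n} k (σ : Permutation′ n) i → ℓ k σ i ≡ reach k σ i + right k σ i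
ℓ-reach k σ i with does (left σ i ≟ toℕ i)
... | true  = refl
... | false = refl

reach≤ : ∀ {n} k (σ : Permutation′ n) i → reach k σ i ≤ toℕ i
reach≤ k σ i with reach-cases k σ i
... | inj₁ (_ , eq) = ≤-trans (≤-reflexive eq) (left≤ σ i)
... | inj₂ (_ , eq) = ≤-trans (≤-reflexive eq) (≤-trans (m∸n≤m (left σ i) k) (left≤ σ i))

-- The preferences with which car σᵢ ends up at spot i.
Window : ∀ {n} → ℕ → Permutation′ n → Fin n → Fin n → Set
Window k σ i a = toℕ a < toℕ i + right k σ i × toℕ i ≤ toℕ a + reach k σ i

window? : ∀ {n} k (σ : Permutation′ n) i a → Dec (Window k σ i a)
window? k σ i a = (toℕ a <? toℕ i + right k σ i) ×-dec (toℕ i ≤? toℕ a + reach k σ i)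

-- The condition on `t` describes the spots from `a - k` to `i - 1`, which the car must find taken
-- in order to move forward to `i`. Since `i - a` is at most `left - k`, they all lie in the left
-- block of `i`.
≤reach⇒smaller : ∀ {n} k (σ : Permutation′ n) (i a : Fin n) →
                 toℕ a < toℕ i → toℕ i ≤ toℕ a + reach k σ i →
                 ∀ t → toℕ t < toℕ i → toℕ a ≤ toℕ t + k → (σ ⟨$⟩ʳ t) Fin.< (σ ⟨$⟩ʳ i)
≤reach⇒smaller k σ i a a<i i≤ t t<i a≤t+k =
  proj₂ (≤⇒leftBlock σ i {t} (<⇒≤ t<i) i≤t+left) t ≤-refl t<i
  where
  open ≤-Reasoning
  i≤t+left : toℕ i ≤ toℕ t + left σ i
  i≤t+left with reach-cases k σ i
  ... | inj₁ (eq , _) = ≤-trans (≤-reflexive (sym eq)) (m≤n+m (left σ i) (toℕ t))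
  ... | inj₂ (_ , eq) with ≤-total k (left σ i)
  -- Here the truncated difference is 0, and no preference before `i` is within reach.
  ...   | inj₂ left≤k = contradiction
          (subst (toℕ i ≤_)
            (trans (cong (toℕ a ℕ.+_) (trans eq (m≤n⇒m∸n≡0 left≤k))) (+-identityʳ _)) i≤)
          (<⇒≱ a<i)
  ...   | inj₁ k≤left = begin
    toℕ i                          ≤⟨ i≤ ⟩
    toℕ a + reach k σ i            ≡⟨ cong (toℕ a ℕ.+_) eq ⟩
    toℕ a + (left σ i ∸ k)         ≤⟨ +-monoˡ-≤ _ a≤t+k ⟩
    toℕ t + k + (left σ i ∸ k)     ≡⟨ +-assoc (toℕ t) k _ ⟩
    toℕ t + (k + (left σ i ∸ k))   ≡⟨ cong (toℕ t ℕ.+_) (m+[n∸m]≡n k≤left) ⟩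
    toℕ t + left σ i               ∎

smaller⇒≤reach : ∀ {n} k (σ : Permutation′ n) (i a : Fin n) → toℕ a < toℕ i →
                 (∀ t → toℕ t < toℕ i → toℕ a ≤ toℕ t + k → (σ ⟨$⟩ʳ t) Fin.< (σ ⟨$⟩ʳ i)) →
                 toℕ i ≤ toℕ a + reach k σ i
smaller⇒≤reach {n} k σ i a a<i smaller with reach-cases k σ i
... | inj₁ (eq , reach≡) =
    ≤-trans (≤-reflexive (sym (trans reach≡ eq))) (m≤n+m (reach k σ i) (toℕ a))
... | inj₂ (left≢i , reach≡) = begin
    toℕ i                                ≤⟨ i≤ ⟩
    toℕ a ∸ k + left σ i                 ≡⟨ cong (toℕ a ∸ k ℕ.+_) (m+[n∸m]≡n k≤left) ⟨
    toℕ a ∸ k + (k + (left σ i ∸ k))     ≡⟨ +-assoc (toℕ a ∸ k) k _ ⟨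
    toℕ a ∸ k + k + (left σ i ∸ k)       ≡⟨ cong (_+ (left σ i ∸ k)) (m∸n+n≡m k≤a) ⟩
    toℕ a + (left σ i ∸ k)               ≡⟨ cong (toℕ a ℕ.+_) reach≡ ⟨
    toℕ a + reach k σ i                  ∎
  where
  open ≤-Reasoning
  a∸k<n : toℕ a ∸ k < n
  a∸k<n = ≤-<-trans (m∸n≤m (toℕ a) k) (toℕ<n a)
  -- The last spot that the car checks when backing up, cut off at the first spot of the street.
  j = fromℕ< a∸k<n

  block : LeftBlock σ i j
  block = subst (_≤ toℕ i) (sym (toℕ-fromℕ< a∸k<n)) (≤-trans (m∸n≤m (toℕ a) k) (<⇒≤ a<i)) ,
    λ t j≤t t<i → smaller t t<i (≤-trans
      (m∸n≤o⇒m≤n+o (toℕ a) k (subst (_≤ toℕ t) (toℕ-fromℕ< a∸k<n) j≤t))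
      (≤-reflexive (+-comm k (toℕ t))))

  i≤ : toℕ i ≤ toℕ a ∸ k + left σ i
  i≤ = subst (λ m → toℕ i ≤ m + left σ i) (toℕ-fromℕ< a∸k<n) (leftBlock⇒≤ σ i block)

  k≤a : k ≤ toℕ a
  k≤a with ≤-total k (toℕ a)
  ... | inj₁ k≤a = k≤a
  -- The spots checked would extend to the start of the street, so `left` would equal `toℕ i`, which
  -- is the other case.
  ... | inj₂ a≤k = contradiction
        (≤-antisym (left≤ σ i) (subst (λ m → toℕ i ≤ m + left σ i) (m≤n⇒m∸n≡0 a≤k) i≤)) left≢i

  k≤left : k ≤ left σ i
  k≤left with ≤-total k (left σ i)
  ... | inj₁ k≤left = k≤left
  ... | inj₂ left≤k = contradiction
        (≤-trans i≤ (≤-trans (+-monoʳ-≤ (toℕ a ∸ k) left≤k) (≤-reflexive (m∸n+n≡m k≤a)))) (<⇒≱ a<i)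

-- The parking process

findᵇ-++ : ∀ {A : Set} (p : A → Bool) xs ys → findᵇ p (xs ++ ys) ≡ (findᵇ p xs <∣> findᵇ p ys)
findᵇ-++ p []       ys = refl
findᵇ-++ p (x ∷ xs) ys with p x
... | true  = refl
... | false = findᵇ-++ p xs ys

module _ {A : Set} (p : A → Bool) {Q : Pred A 0ℓ} (Q? : Decidable Q) where

  -- Stated for an arbitrary `g` because the tail of `allFin` is a `tabulate` of `suc` and not again
  -- an `allFin`.
  findᵇ-filter-tabulate⁻ : ∀ {n} (g : Fin n → A) {y} → findᵇ p (filter Q? (tabulate g)) ≡ just y →
    ∃ λ x → g x ≡ y × Q y × (∀ t → t Fin.< x → Q (g t) → p (g t) ≡ false)
  findᵇ-filter-tabulate⁻ {suc n} g eq with Q? (g zero)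
  ... | no ¬q with findᵇ-filter-tabulate⁻ (g ∘ suc) eq
  ...   | x , gx , qy , before = suc x , gx , qy ,
          λ { zero _ q → contradiction q ¬q ; (suc t) (s≤s t<x) → before t t<x }
  findᵇ-filter-tabulate⁻ {suc n} g eq | yes q with p (g zero) in pz
  ... | true  = zero , just-injective eq , subst Q (just-injective eq) q , λ _ ()
  ... | false with findᵇ-filter-tabulate⁻ (g ∘ suc) eq
  ...   | x , gx , qy , before = suc x , gx , qy ,
          λ { zero _ _ → pz ; (suc t) (s≤s t<x) → before t t<x }

  findᵇ-filter-tabulate⁺ : ∀ {n} (g : Fin n → A) x → Q (g x) → p (g x) ≡ true →
    (∀ t → t Fin.< x → Q (g t) → p (g t) ≡ false) → findᵇ p (filter Q? (tabulate g)) ≡ just (g x)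
  findᵇ-filter-tabulate⁺ g zero qx px before with Q? (g zero)
  ... | no ¬q = contradiction qx ¬q
  ... | yes _ rewrite px = refl
  findᵇ-filter-tabulate⁺ g (suc x) qx px before with Q? (g zero)
  ... | no _ = findᵇ-filter-tabulate⁺ (g ∘ suc) x qx px (λ t t<x → before (suc t) (s≤s t<x))
  ... | yes q rewrite before zero (s≤s z≤n) q =
        findᵇ-filter-tabulate⁺ (g ∘ suc) x qx px (λ t t<x → before (suc t) (s≤s t<x))

-- The spot found by a single car

module _ {n} (empty : Fin n → Bool) where

  Taken : Fin n → Set
  Taken t = empty t ≡ false

  backward-nothing⁻ : ∀ k a → findᵇ empty (backward k a) ≡ nothing →
                      ∀ t → toℕ t < toℕ a → toℕ a ≤ toℕ t + k → Taken t
  backward-nothing⁻ zero    a       eq t t<a a≤t+0 =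
    contradiction (≤-trans a≤t+0 (≤-reflexive (+-identityʳ _))) (<⇒≱ t<a)
  backward-nothing⁻ (suc k) (suc a) eq t t<a a≤ with empty (inject₁ a) in ea
  ... | false with m≤n⇒m<n∨m≡n (≤-pred t<a)
  ...   | inj₁ t<a′ = backward-nothing⁻ k (inject₁ a) eq t
            (subst (toℕ t <_) (sym (toℕ-inject₁ a)) t<a′)
            (subst (_≤ toℕ t + k) (sym (toℕ-inject₁ a))
              (≤-pred (subst (suc (toℕ a) ≤_) (+-suc (toℕ t) k) a≤)))
  ...   | inj₂ t≡a = subst Taken (sym (toℕ-injective (trans t≡a (sym (toℕ-inject₁ a))))) ea

  backward-nothing⁺ : ∀ k a → (∀ t → toℕ t < toℕ a → toℕ a ≤ toℕ t + k → Taken t) →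
                      findᵇ empty (backward k a) ≡ nothing
  backward-nothing⁺ zero    a       taken = refl
  backward-nothing⁺ (suc k) zero    taken = refl
  backward-nothing⁺ (suc k) (suc a) taken
    rewrite taken (inject₁ a) (s≤s (≤-reflexive (toℕ-inject₁ a)))
              (≤-trans (s≤s (m≤m+n (toℕ a) k))
                (≤-reflexive (trans (sym (+-suc (toℕ a) k))
                                    (cong (_+ suc k) (sym (toℕ-inject₁ a)))))) =
    backward-nothing⁺ k (inject₁ a) λ t t<a a≤t+k → taken t
      (m≤n⇒m≤1+n (subst (toℕ t <_) (toℕ-inject₁ a) t<a))
      (≤-trans (s≤s (subst (_≤ toℕ t + k) (toℕ-inject₁ a) a≤t+k))
               (≤-reflexive (sym (+-suc (toℕ t) k))))

  backward-just⁻ : ∀ k a {i} → findᵇ empty (backward k a) ≡ just i →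
                   toℕ i < toℕ a × toℕ a ≤ toℕ i + k ×
                   (∀ t → toℕ i < toℕ t → toℕ t < toℕ a → Taken t)
  backward-just⁻ (suc k) (suc a) {i} eq with empty (inject₁ a) in ea
  backward-just⁻ (suc k) (suc a) refl | true =
    s≤s (≤-reflexive (toℕ-inject₁ a)) ,
    ≤-trans (s≤s (m≤m+n (toℕ a) k))
      (≤-reflexive (trans (sym (+-suc (toℕ a) k)) (cong (_+ suc k) (sym (toℕ-inject₁ a))))) ,
    λ t i<t t<a → contradiction (≤-trans (≤-pred t<a) (≤-reflexive (sym (toℕ-inject₁ a)))) (<⇒≱ i<t)
  backward-just⁻ (suc k) (suc a) {i} eq | false with backward-just⁻ k (inject₁ a) eq
  ... | i<a , a≤i+k , between =
    m≤n⇒m≤1+n (subst (toℕ i <_) (toℕ-inject₁ a) i<a) ,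
    ≤-trans (s≤s (subst (_≤ toℕ i + k) (toℕ-inject₁ a) a≤i+k))
            (≤-reflexive (sym (+-suc (toℕ i) k))) ,
    taken
    where
    taken : ∀ t → toℕ i < toℕ t → toℕ t < suc (toℕ a) → Taken t
    taken t i<t t<a with m≤n⇒m<n∨m≡n (≤-pred t<a)
    ... | inj₁ t<a′ = between t i<t (subst (toℕ t <_) (sym (toℕ-inject₁ a)) t<a′)
    ... | inj₂ t≡a  = subst Taken (sym (toℕ-injective (trans t≡a (sym (toℕ-inject₁ a))))) ea

  backward-just⁺ : ∀ k a {i} → empty i ≡ true → toℕ i < toℕ a → toℕ a ≤ toℕ i + k →
                   (∀ t → toℕ i < toℕ t → toℕ t < toℕ a → Taken t) →
                   findᵇ empty (backward k a) ≡ just i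
  backward-just⁺ zero    a {i} ei i<a a≤i+0 taken =
    contradiction (≤-trans a≤i+0 (≤-reflexive (+-identityʳ _))) (<⇒≱ i<a)
  backward-just⁺ (suc k) (suc a) {i} ei i<a a≤ taken with m≤n⇒m<n∨m≡n (≤-pred i<a)
  ... | inj₂ i≡a with toℕ-injective {i = i} {j = inject₁ a} (trans i≡a (sym (toℕ-inject₁ a)))
  ...   | refl rewrite ei = refl
  backward-just⁺ (suc k) (suc a) {i} ei i<a a≤ taken | inj₁ i<a′
    rewrite taken (inject₁ a) (subst (toℕ i <_) (sym (toℕ-inject₁ a)) i<a′)
              (s≤s (≤-reflexive (toℕ-inject₁ a))) =
    backward-just⁺ k (inject₁ a) ei (subst (toℕ i <_) (sym (toℕ-inject₁ a)) i<a′)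
      (subst (_≤ toℕ i + k) (sym (toℕ-inject₁ a))
        (≤-pred (subst (suc (toℕ a) ≤_) (+-suc (toℕ i) k) a≤)))
      λ t i<t t<a → taken t i<t (m≤n⇒m≤1+n (subst (toℕ t <_) (toℕ-inject₁ a) t<a))

  -- The first alternative covers parking at `a` itself and backing up. In the second, one condition
  -- covers the spots checked behind `a`, the spot `a`, and the spots passed on the way forward.
  Finds : ℕ → Fin n → Fin n → Set
  Finds k a i =
    (toℕ i ≤ toℕ a × toℕ a ≤ toℕ i + k × (∀ t → toℕ i < toℕ t → toℕ t ≤ toℕ a → Taken t)) ⊎
    (toℕ a < toℕ i × (∀ t → toℕ t < toℕ i → toℕ a ≤ toℕ t + k → Taken t))

  search⁻ : ∀ k a {i} → findᵇ empty (searchOrder k a) ≡ just i → Finds k a i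
  search⁻ k a eq with empty a in ea
  search⁻ k a refl | true =
    inj₁ (≤-refl , m≤m+n (toℕ a) k , λ t a<t t≤a → contradiction t≤a (<⇒≱ a<t))
  search⁻ k a {i} eq | false with findᵇ empty (backward k a) in eb
                                 | trans (sym (findᵇ-++ empty (backward k a) (forward a))) eq
  search⁻ k a {i} eq | false | just _ | refl with backward-just⁻ k a eb
  ... | i<a , a≤i+k , between = inj₁ (<⇒≤ i<a , a≤i+k , taken)
    where
    taken : ∀ t → toℕ i < toℕ t → toℕ t ≤ toℕ a → Taken t
    taken t i<t t≤a with m≤n⇒m<n∨m≡n t≤a
    ... | inj₁ t<a = between t i<t t<a
    ... | inj₂ t≡a = subst Taken (sym (toℕ-injective t≡a)) ea
  search⁻ k a {i} eq | false | nothing | ef with findᵇ-filter-tabulate⁻ empty (a Finₚ.<?_) id ef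
  ... | _ , refl , a<i , before = inj₂ (a<i , taken)
    where
    taken : ∀ t → toℕ t < toℕ i → toℕ a ≤ toℕ t + k → Taken t
    taken t t<i a≤t+k with <-cmp (toℕ t) (toℕ a)
    ... | tri< t<a _ _ = backward-nothing⁻ k a eb t t<a a≤t+k
    ... | tri≈ _ t≡a _ = subst Taken (sym (toℕ-injective t≡a)) ea
    ... | tri> _ _ a<t = before t t<i a<t

  search⁺ : ∀ k a {i} → empty i ≡ true → Finds k a i → findᵇ empty (searchOrder k a) ≡ just i
  search⁺ k a {i} ei (inj₁ (i≤a , a≤i+k , taken)) with m≤n⇒m<n∨m≡n i≤a
  ... | inj₂ i≡a with toℕ-injective i≡a
  ...   | refl rewrite ei = refl
  search⁺ k a {i} ei (inj₁ (i≤a , a≤i+k , taken)) | inj₁ i<a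
    rewrite taken a i<a ≤-refl
          | findᵇ-++ empty (backward k a) (forward a)
          | backward-just⁺ k a ei i<a a≤i+k (λ t i<t t<a → taken t i<t (<⇒≤ t<a)) = refl
  search⁺ k a {i} ei (inj₂ (a<i , taken))
    rewrite taken a a<i (m≤m+n (toℕ a) k)
          | findᵇ-++ empty (backward k a) (forward a)
          | backward-nothing⁺ k a (λ t t<a → taken t (<-trans t<a a<i)) =
    findᵇ-filter-tabulate⁺ empty (a Finₚ.<?_) id i a<i ei
      λ t t<i a<t → taken t t<i (≤-trans (<⇒≤ a<t) (m≤m+n (toℕ t) k))

-- The street filling up towards a permutation

module _ {n} (σ : Permutation′ n) where

  OneLine : Street n → Set
  OneLine st = ∀ s → lookup st s ≡ just (σ ⟨$⟩ʳ s)

  -- The street on the way to σ just before car number j arrives.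
  Stage : ℕ → Street n → Set
  Stage j st = ∀ s → (toℕ (σ ⟨$⟩ʳ s) < j → lookup st s ≡ just (σ ⟨$⟩ʳ s)) ×
                     (j ≤ toℕ (σ ⟨$⟩ʳ s) → lookup st s ≡ nothing)

  stage-zero : Stage 0 (replicate n nothing)
  stage-zero s = (λ ()) , λ _ → lookup-replicate s nothing

  stage-end : ∀ st → Stage n st → OneLine st
  stage-end st stage s = proj₁ (stage s) (toℕ<n (σ ⟨$⟩ʳ s))

  stage-suc : ∀ st i → Stage (toℕ (σ ⟨$⟩ʳ i)) st →
              Stage (suc (toℕ (σ ⟨$⟩ʳ i))) (st [ i ]≔ just (σ ⟨$⟩ʳ i))
  stage-suc st i stage s with s Finₚ.≟ i
  ... | yes refl = (λ _ → lookup∘update s st _) , λ lt → contradiction lt (n≮n _)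
  ... | no s≢i   =
        (λ lt → trans (lookup∘update′ s≢i st _) (proj₁ (stage s)
          (≤∧≢⇒< (≤-pred lt) (s≢i ∘ ⟨$⟩ʳ-injective σ ∘ toℕ-injective)))) ,
        λ lt → trans (lookup∘update′ s≢i st _) (proj₂ (stage s) (<⇒≤ lt))

  module _ (k : ℕ) (st : Street n) (i : Fin n) (stage : Stage (toℕ (σ ⟨$⟩ʳ i)) st) where

    private
      empty : Fin n → Bool
      empty t = is-nothing (lookup st t)

    taken⇒< : ∀ t → empty t ≡ false → (σ ⟨$⟩ʳ t) Fin.< (σ ⟨$⟩ʳ i)
    taken⇒< t eq with toℕ (σ ⟨$⟩ʳ t) <? toℕ (σ ⟨$⟩ʳ i)
    ... | yes lt = lt
    ... | no ≮   with trans (sym (cong is-nothing (proj₂ (stage t) (≮⇒≥ ≮)))) eq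
    ...   | ()

    <⇒taken : ∀ t → (σ ⟨$⟩ʳ t) Fin.< (σ ⟨$⟩ʳ i) → empty t ≡ false
    <⇒taken t lt = cong is-nothing (proj₁ (stage t) lt)

    -- At this stage a spot is taken exactly when its entry of `σ` is smaller than the one at `i`.
    -- The two alternatives of `Finds` thus become a right block from `i` to `a` and the hypothesis
    -- of `smaller⇒≤reach`.
    search-window⁻ : ∀ a → firstEmpty st (searchOrder k a) ≡ just i → Window k σ i a
    search-window⁻ a eq with search⁻ empty k a eq
    ... | inj₁ (i≤a , a≤i+k , taken) =
          rightBlock⇒< σ i k {a} (i≤a , a≤i+k , block) , ≤-trans i≤a (m≤m+n (toℕ a) _)
      where
      block : ∀ t → toℕ i ≤ toℕ t → toℕ t ≤ toℕ a → toℕ (σ ⟨$⟩ʳ t) ≤ toℕ (σ ⟨$⟩ʳ i)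
      block t i≤t t≤a with m≤n⇒m<n∨m≡n i≤t
      ... | inj₁ i<t = <⇒≤ (taken⇒< t (taken t i<t t≤a))
      ... | inj₂ i≡t = ≤-reflexive (cong (λ s → toℕ (σ ⟨$⟩ʳ s)) (sym (toℕ-injective i≡t)))
    ... | inj₂ (a<i , taken) =
          <-≤-trans a<i (m≤m+n (toℕ i) _) ,
          smaller⇒≤reach k σ i a a<i (λ t t<i a≤t+k → taken⇒< t (taken t t<i a≤t+k))

    search-window⁺ : ∀ a → Window k σ i a → firstEmpty st (searchOrder k a) ≡ just i
    search-window⁺ a (a<i+right , i≤a+reach) =
      search⁺ empty k a (cong is-nothing (proj₂ (stage i) ≤-refl)) finds
      where
      finds : Finds empty k a i
      finds with toℕ i ≤? toℕ a
      ... | no i≰a  = inj₂ (≰⇒> i≰a , λ t t<i a≤t+k →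
              <⇒taken t (≤reach⇒smaller k σ i a (≰⇒> i≰a) i≤a+reach t t<i a≤t+k))
      ... | yes i≤a with <⇒rightBlock σ i k {a} i≤a a<i+right
      ...   | _ , a≤i+k , block = inj₁ (i≤a , a≤i+k , λ t i<t t≤a → <⇒taken t
              -- Right blocks are defined by a weak inequality; it is strict away from `i` because
              -- `σ` is injective.
              (≤∧≢⇒< (block t (<⇒≤ i<t) t≤a)
                     (<⇒≢ i<t ∘ cong toℕ ∘ sym ∘ ⟨$⟩ʳ-injective σ ∘ toℕ-injective)))

  module _ (k : ℕ) (α : Preference n) where

    CarWindow : Fin n → Set
    CarWindow c = Window k σ (σ ⟨$⟩ˡ c) (lookup α c)

    stage-at : ∀ {j c} st → toℕ c ≡ j → Stage j st → Stage (toℕ (σ ⟨$⟩ʳ (σ ⟨$⟩ˡ c))) st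
    stage-at st eq = subst (λ m → Stage m st) (sym (trans (cong toℕ (inverseʳ σ)) eq))

    stage-park : ∀ {j c} st → toℕ c ≡ j → Stage j st → Stage (suc j) (st [ σ ⟨$⟩ˡ c ]≔ just c)
    stage-park {j} {c} st eq stage =
      subst₂ (λ m d → Stage (suc m) (st [ σ ⟨$⟩ˡ c ]≔ just d))
             (trans (cong toℕ (inverseʳ σ)) eq) (inverseʳ σ)
             (stage-suc st (σ ⟨$⟩ˡ c) (stage-at st eq stage))

    -- The induction runs over the final segments of the list of cars: `f` enumerates the `m` cars
    -- from number `j` on.
    parkCars⁺ : ∀ j m (f : Fin m → Fin n) → (∀ x → toℕ (f x) ≡ j + toℕ x) → j + m ≡ n →
                ∀ st → Stage j st → (∀ x → CarWindow (f x)) →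
                ∃ λ st′ → parkCars k α (tabulate f) st ≡ just st′ × OneLine st′
    parkCars⁺ j zero    f f≗ j+m≡n st stage w =
      st , refl , stage-end st (subst (λ m → Stage m st) (trans (sym (+-identityʳ j)) j+m≡n) stage)
    parkCars⁺ j (suc m) f f≗ j+m≡n st stage w
      with parkCars⁺ (suc j) m (f ∘ suc) (λ x → trans (f≗ (suc x)) (+-suc j (toℕ x)))
             (trans (sym (+-suc j m)) j+m≡n) _ (stage-park st toℕ-f stage) (w ∘ suc)
      where
      toℕ-f : toℕ (f zero) ≡ j
      toℕ-f = trans (f≗ zero) (+-identityʳ j)
    ... | st′ , eq , oneLine =
      st′ , trans (cong (_>>= parkCars k α (tabulate (f ∘ suc))) parked) eq , oneLine
      where
      parked : parkCar k α (f zero) st ≡ just (st [ σ ⟨$⟩ˡ f zero ]≔ just (f zero))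
      parked = cong (Maybe.map (λ s → st [ s ]≔ just (f zero)))
        (search-window⁺ k st (σ ⟨$⟩ˡ f zero)
          (stage-at st (trans (f≗ zero) (+-identityʳ j)) stage) (lookup α (f zero)) (w zero))

    -- The final street determines where the next car parks. This yields both its window and the
    -- next stage, so the induction can continue.
    parkCars⁻ : ∀ j m (f : Fin m → Fin n) → (∀ x → toℕ (f x) ≡ j + toℕ x) →
                ∀ st {st′} → Stage j st → parkCars k α (tabulate f) st ≡ just st′ → OneLine st′ →
                ∀ x → CarWindow (f x)
    parkCars⁻ j (suc m) f f≗ st {st′} stage eq oneLine
      with firstEmpty st (searchOrder k (lookup α (f zero))) in fe
    ... | just s = λ { zero → here ; (suc x) → parkCars⁻ (suc j) m (f ∘ suc)
                         (λ x → trans (f≗ (suc x)) (+-suc j (toℕ x))) _ stage′ eq oneLine x }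
      where
      toℕ-f : toℕ (f zero) ≡ j
      toℕ-f = trans (f≗ zero) (+-identityʳ j)

      s≡ : s ≡ σ ⟨$⟩ˡ f zero
      -- The car is still at `s` in the final street, where `oneLine` puts car `σ ⟨$⟩ʳ s`.
      s≡ = trans (sym (inverseˡ σ)) (cong (σ ⟨$⟩ˡ_) (just-injective (trans (sym (oneLine s))
        (parkCars-keeps k α (tabulate (f ∘ suc)) _ eq (lookup∘update s st _)))))

      here : CarWindow (f zero)
      here = search-window⁻ k st (σ ⟨$⟩ˡ f zero) (stage-at st toℕ-f stage) (lookup α (f zero))
               (trans fe (cong just s≡))

      stage′ : Stage (suc j) (st [ s ]≔ just (f zero))
      stage′ = subst (λ s → Stage (suc j) (st [ s ]≔ just (f zero))) (sym s≡)
                 (stage-park st toℕ-f stage)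

    outcome⁺ : (∀ c → CarWindow c) → ∃ λ st → outcome k α ≡ just st × OneLine st
    outcome⁺ = parkCars⁺ 0 n id (λ _ → refl) refl _ stage-zero

    outcome⁻ : ∀ {st} → outcome k α ≡ just st → OneLine st → ∀ c → CarWindow c
    outcome⁻ = parkCars⁻ 0 n id (λ _ → refl) _ stage-zero

-- The generating function

-- The area refers to `φ k p`, which agrees with `σ` only pointwise.
right-cong : ∀ {n} k {π σ : Permutation′ n} → π Perm.≈ σ → ∀ i → right k π i ≡ right k σ i
right-cong {n} k {π} {σ} π≈σ i =
  cong (λ rs → max 0 (map (λ r → suc (toℕ r) ∸ toℕ i) rs))
       (filter-≐ (rightBlock? k π i) (rightBlock? k σ i)
         (transport π σ π≈σ , transport σ π (sym ∘ π≈σ)) (allFin n))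
  where
  transport : ∀ (π σ : Permutation′ n) → π Perm.≈ σ →
              ∀ {r} → RightBlock k π i r → RightBlock k σ i r
  transport π σ π≈σ (i≤r , r≤i+k , b) =
    i≤r , r≤i+k , λ t i≤t t≤r → subst₂ Fin._≤_ (π≈σ t) (π≈σ i) (b t i≤t t≤r)

-- The area summand with `n - i` replaced by `i - 1` in one-based numbering, and with spot and
-- preference made independent arguments.
exponent : ∀ {n} → ℕ → Permutation′ n → Fin n → Fin n → ℤ
exponent k σ i a = + toℕ i ℤ.+ + right k σ i ℤ.- + one-based a

-- The value zero off the window allows sums over all preferences in place of sums over the fiber.
weight : ∀ {n} → ℕ → Permutation′ n → Fin n → Fin n → Laurent
weight k σ i a = if does (window? k σ i a) then q^ exponent k σ i a else 0ᴸ

∑-q^ : ∀ {A : Set} (xs : List A) (e : A → ℤ) → ∑ xs (λ x → q^ e x) ≡ map (λ x → 1ℤ , e x) xs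
∑-q^ []       e = refl
∑-q^ (x ∷ xs) e = cong (_ ∷_) (∑-q^ xs e)

∑-if : ∀ {A : Set} {P : Pred A 0ℓ} (P? : Decidable P) (F : A → Laurent) xs →
       ∑ xs (λ x → if does (P? x) then F x else 0ᴸ) ≡ ∑ (filter P? xs) F
∑-if P? F []       = refl
∑-if P? F (x ∷ xs) with does (P? x)
... | true  = cong (F x +ᴸ_) (∑-if P? F xs)
... | false = ∑-if P? F xs

∑-cong : ∀ {A : Set} (xs : List A) {F G : A → Laurent} → (∀ x → F x ≡ G x) → ∑ xs F ≡ ∑ xs G
∑-cong xs F≗G = cong (foldr _+ᴸ_ 0ᴸ) (map-cong F≗G xs)

∑-mapMaybe : ∀ {A B : Set} (g : A → Maybe B) (F : B → Laurent) xs →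
             ∑ (mapMaybe g xs) F ≡ ∑ xs (λ x → maybe′ F 0ᴸ (g x))
∑-mapMaybe g F []       = refl
∑-mapMaybe g F (x ∷ xs) with g x
... | nothing = ∑-mapMaybe g F xs
... | just y  = cong (F y +ᴸ_) (∑-mapMaybe g F xs)

exponent-+ : ∀ {n} k (σ : Permutation′ n) (i a : Fin n) → suc (toℕ a) ≤ toℕ i + right k σ i →
             exponent k σ i a ≡ + (toℕ i + right k σ i ∸ suc (toℕ a))
exponent-+ k σ i a le = trans (ℤₚ.m-n≡m⊖n (toℕ i + right k σ i) (suc (toℕ a))) (ℤₚ.⊖-≥ le)

-- Both lists are free of repetitions, so it is enough that they have the same members: the
-- exponents in the window are the integers from 0 to `ℓ - 1`.
window-exponents : ∀ {n} k (σ : Permutation′ n) i →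
                   map (λ a → 1ℤ , exponent k σ i a) (filter (window? k σ i) (allFin n)) ↭
                   map (λ j → 1ℤ , + j) (upTo (ℓ k σ i))
window-exponents {n} k σ i = ∼bag⇒↭ (unique∧set⇒bag
  (Uniqueₚ.map⁺ term-injective (Uniqueₚ.filter⁺ (window? k σ i) (Uniqueₚ.allFin⁺ n)))
  (Uniqueₚ.map⁺ (ℤₚ.+-injective ∘ cong proj₂) (Uniqueₚ.upTo⁺ (ℓ k σ i)))
  (mk⇔ to from))
  where
  open ≤-Reasoning
  R = right k σ i
  h = toℕ i + R

  window : List (Fin n)
  window = filter (window? k σ i) (allFin n)

  term : Fin n → ℤ × ℤ
  term a = 1ℤ , exponent k σ i a

  term-injective : ∀ {a b} → term a ≡ term b → a ≡ b
  term-injective {a} {b} eq = toℕ-injective (suc-injective (ℤₚ.+-injective (ℤₚ.neg-injective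
    (ℤ-+-cancelˡ (+ h) _ _ (cong proj₂ eq)))))

  to : ∀ {x} → x ∈ map term window → x ∈ map (λ j → 1ℤ , + j) (upTo (ℓ k σ i))
  to x∈ with ∈-map⁻ term x∈
  ... | a , a∈ , refl with proj₂ (∈-filter⁻ (window? k σ i) {xs = allFin n} a∈)
  ...   | a<h , i≤a+reach = subst (_∈ map (λ j → 1ℤ , + j) (upTo (ℓ k σ i)))
            (cong (1ℤ ,_) (sym (exponent-+ k σ i a a<h)))
            (∈-map⁺ _ (∈-upTo⁺ (subst (h ∸ suc (toℕ a) <_) (sym (ℓ-reach k σ i)) small)))
    where
    small : h ∸ suc (toℕ a) < reach k σ i + R
    small = +-cancelˡ-< (suc (toℕ a)) _ _ (begin-strict
      suc (toℕ a) + (h ∸ suc (toℕ a))   ≡⟨ m+[n∸m]≡n a<h ⟩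
      toℕ i + R                         ≤⟨ +-monoˡ-≤ R i≤a+reach ⟩
      toℕ a + reach k σ i + R           ≡⟨ +-assoc (toℕ a) _ R ⟩
      toℕ a + (reach k σ i + R)         <⟨ n<1+n _ ⟩
      suc (toℕ a) + (reach k σ i + R)   ∎)

  from : ∀ {x} → x ∈ map (λ j → 1ℤ , + j) (upTo (ℓ k σ i)) → x ∈ map term window
  from x∈ with ∈-map⁻ _ x∈
  ... | j , j∈ , refl = subst (_∈ map term window) (cong (1ℤ ,_) exp≡)
          (∈-map⁺ term (∈-filter⁺ (window? k σ i) (∈-allFin a) (a<h , i≤a+reach)))
    where
    j<ℓ : j < reach k σ i + R
    j<ℓ = subst (j <_) (ℓ-reach k σ i) (∈-upTo⁻ j∈)

    -- As `reach` is at most `toℕ i`, the window does not extend past the start of the street and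
    -- the subtraction defining `a` is exact.
    j<h : suc j ≤ h
    j<h = ≤-trans j<ℓ (+-monoˡ-≤ R (reach≤ k σ i))

    a<n : h ∸ suc j < n
    a<n = <-≤-trans (∸-monoʳ-< (s≤s z≤n) j<h) (i+right≤n σ i k)

    a = fromℕ< a<n

    toℕ-a : toℕ a ≡ h ∸ suc j
    toℕ-a = toℕ-fromℕ< a<n

    a+j≡h : suc (toℕ a) + j ≡ h
    a+j≡h = trans (sym (+-suc (toℕ a) j)) (trans (cong (_+ suc j) toℕ-a) (m∸n+n≡m j<h))

    a<h : suc (toℕ a) ≤ h
    a<h = ≤-trans (m≤m+n _ j) (≤-reflexive a+j≡h)

    exp≡ : exponent k σ i a ≡ + j
    exp≡ = trans (exponent-+ k σ i a a<h)
      (cong +_ (trans (cong (_∸ suc (toℕ a)) (sym a+j≡h)) (m+n∸m≡n (suc (toℕ a)) j)))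

    i≤a+reach : toℕ i ≤ toℕ a + reach k σ i
    i≤a+reach = +-cancelʳ-≤ R _ _ (begin
      toℕ i + R                     ≡⟨ a+j≡h ⟨
      suc (toℕ a) + j               ≡⟨ +-suc (toℕ a) j ⟨
      toℕ a + suc j                 ≤⟨ +-monoʳ-≤ (toℕ a) j<ℓ ⟩
      toℕ a + (reach k σ i + R)     ≡⟨ +-assoc (toℕ a) _ R ⟨
      toℕ a + reach k σ i + R       ∎)

∑-weight : ∀ {n} k (σ : Permutation′ n) i → ∑ (allFin n) (weight k σ i) ↭ [ ℓ k σ i ]q
∑-weight {n} k σ i = begin
  ∑ (allFin n) (weight k σ i)
    ≡⟨ ∑-if (window? k σ i) (λ a → q^ exponent k σ i a) (allFin n) ⟩
  ∑ window (λ a → q^ exponent k σ i a)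
    ≡⟨ ∑-q^ window (exponent k σ i) ⟩
  map (λ a → 1ℤ , exponent k σ i a) window
    ↭⟨ window-exponents k σ i ⟩
  map (λ j → 1ℤ , + j) (upTo (ℓ k σ i))
    ≡⟨ ∑-q^ (upTo (ℓ k σ i)) (λ j → + j) ⟨
  [ ℓ k σ i ]q ∎
  where
  open PermutationReasoning
  window = filter (window? k σ i) (allFin n)

∏-q^ : ∀ {m} (w : Fin m → Laurent) (e : Fin m → ℤ) → (∀ c → w c ≡ q^ e c) → ∏ w ≡ q^ sum e
∏-q^ {zero}  w e w≡ = refl
-- A product of two monomials `q^` reduces by computation to `q^` of the sum of their exponents.
∏-q^ {suc m} w e w≡ = cong₂ _*ᴸ_ (w≡ zero) (∏-q^ (w ∘ suc) (e ∘ suc) (w≡ ∘ suc))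

∏-zero : ∀ {m} (w : Fin m → Laurent) c → w c ≡ 0ᴸ → ∏ w ≡ 0ᴸ
∏-zero w zero    eq = cong (_*ᴸ ∏ (w ∘ suc)) eq
∏-zero w (suc c) eq = trans (cong (w zero *ᴸ_) (∏-zero (w ∘ suc) c eq)) (*ᴸ-zeroʳ (w zero))

-- Reversing the order of the spots carries one sum into the other.
sum-opposite : ∀ n → sum {n} (λ i → + n ℤ.- + one-based i) ≡ sum {n} (λ i → + toℕ i)
sum-opposite n = begin
  sum {n} (λ i → + n ℤ.- + one-based i)
    ≡⟨ sum-cong-≗ {n} (λ i → trans (ℤₚ.m-n≡m⊖n n (one-based i))
         (trans (ℤₚ.⊖-≥ (toℕ<n i)) (cong +_ (sym (opposite-prop i))))) ⟩
  sum {n} (λ i → + toℕ (opposite i))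
    ≡⟨ sum-permute {n} {n} (λ i → + toℕ i) Perm.reverse ⟨
  sum {n} (λ i → + toℕ i) ∎
  where open ≡-Reasoning

-- The fiber as a product of windows

module _ {n} (k : ℕ) (σ : Permutation′ n) where

  -- The two sums do not agree term by term: in a summand of the area, `i` is a spot in `right` but
  -- a car in the preference. The parts are separated so that only the spot part is reindexed by the
  -- inverse of `σ`.
  area-exponent : ∀ (p : PF n k) → φ k p Perm.≈ σ →
                  area k p ≡ sum {n} (λ c → exponent k σ (σ ⟨$⟩ˡ c) (lookup (proj₁ p) c))
  area-exponent p@(α , _) φ≈σ = begin
    sum {n} (λ i → (+ n ℤ.- + one-based i) ℤ.+ + right k (φ k p) i ℤ.+ b i)
      ≡⟨ sum-cong-≗ {n} (λ i → cong (λ r → (+ n ℤ.- + one-based i) ℤ.+ + r ℤ.+ b i)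
           (right-cong k {φ k p} {σ} φ≈σ i)) ⟩
    sum {n} (λ i → (+ n ℤ.- + one-based i) ℤ.+ R i ℤ.+ b i)
      ≡⟨ ∑-distrib-+ {n} (λ i → (+ n ℤ.- + one-based i) ℤ.+ R i) b ⟩
    sum {n} (λ i → (+ n ℤ.- + one-based i) ℤ.+ R i) ℤ.+ sum {n} b
      ≡⟨ cong (ℤ._+ sum {n} b) (∑-distrib-+ {n} (λ i → + n ℤ.- + one-based i) R) ⟩
    sum {n} (λ i → + n ℤ.- + one-based i) ℤ.+ sum {n} R ℤ.+ sum {n} b
      ≡⟨ cong (λ s → s ℤ.+ sum {n} R ℤ.+ sum {n} b) (sum-opposite n) ⟩
    sum {n} (λ i → + toℕ i) ℤ.+ sum {n} R ℤ.+ sum {n} b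
      ≡⟨ cong (ℤ._+ sum {n} b) (∑-distrib-+ {n} (λ i → + toℕ i) R) ⟨
    sum {n} (λ i → + toℕ i ℤ.+ R i) ℤ.+ sum {n} b
      ≡⟨ cong (ℤ._+ sum {n} b) (sum-permute {n} (λ i → + toℕ i ℤ.+ R i) (Perm.flip σ)) ⟩
    sum {n} (λ c → + toℕ (σ ⟨$⟩ˡ c) ℤ.+ R (σ ⟨$⟩ˡ c)) ℤ.+ sum {n} b
      ≡⟨ ∑-distrib-+ {n} (λ c → + toℕ (σ ⟨$⟩ˡ c) ℤ.+ R (σ ⟨$⟩ˡ c)) b ⟨
    sum {n} (λ c → + toℕ (σ ⟨$⟩ˡ c) ℤ.+ R (σ ⟨$⟩ˡ c) ℤ.+ b c) ∎
    where
    open ≡-Reasoning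
    R b : Fin n → ℤ
    R i = + right k σ i
    b c = ℤ.- + one-based (lookup α c)

  fiberWeight : Preference n → Laurent
  fiberWeight α = ∏ (λ c → weight k σ (σ ⟨$⟩ˡ c) (lookup α c))

  ∏-weight-windows : ∀ α → (∀ c → CarWindow σ k α c) →
                     fiberWeight α ≡ q^ sum (λ c → exponent k σ (σ ⟨$⟩ˡ c) (lookup α c))
  ∏-weight-windows α w = ∏-q^ (λ c → weight k σ (σ ⟨$⟩ˡ c) (lookup α c)) _
    λ c → if-yes (window? k σ (σ ⟨$⟩ˡ c) (lookup α c)) (w c)
    where
    if-yes : ∀ {P A : Set} (P? : Dec P) {x y : A} → P → (if does P? then x else y) ≡ x
    if-yes (yes _) _ = refl
    if-yes (no ¬p) p = contradiction p ¬p

  ∏-weight-zero : ∀ α → ¬ (∀ c → CarWindow σ k α c) → fiberWeight α ≡ 0ᴸ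
  ∏-weight-zero α ¬w with ¬∀⟶∃¬ n (CarWindow σ k α) (λ c → window? k σ (σ ⟨$⟩ˡ c) (lookup α c)) ¬w
  ... | c , ¬wc = ∏-zero (λ c → weight k σ (σ ⟨$⟩ˡ c) (lookup α c)) c
                    (if-no (window? k σ (σ ⟨$⟩ˡ c) (lookup α c)) ¬wc)
    where
    if-no : ∀ {P A : Set} (P? : Dec P) {x y : A} → ¬ P → (if does P? then x else y) ≡ y
    if-no (yes p) ¬p = contradiction p ¬p
    if-no (no _)  _  = refl

  windows⇒naples : ∀ α → (∀ c → CarWindow σ k α c) → IsNaples k α
  windows⇒naples α w with outcome⁺ σ k α w
  ... | _ , eq , _ = subst Is-just (sym eq) (MaybeAny.just tt)

  windows⇒φ≈ : ∀ (p : PF n k) → (∀ c → CarWindow σ k (proj₁ p) c) → φ k p Perm.≈ σ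
  windows⇒φ≈ p w i with outcome⁺ σ k (proj₁ p) w
  ... | st , eq , oneLine = just-injective (trans (sym (carAt-occupies p i))
    (trans (cong (λ st → lookup st i)
                 (just-injective (trans (sym (finalStreet-outcome p)) eq)))
           (oneLine i)))

  φ≈⇒windows : ∀ (p : PF n k) → φ k p Perm.≈ σ → ∀ c → CarWindow σ k (proj₁ p) c
  φ≈⇒windows p φ≈σ = outcome⁻ σ k (proj₁ p) (finalStreet-outcome p)
    (λ s → trans (carAt-occupies p s) (cong just (φ≈σ s)))

  -- A preference outside the fiber either does not park all cars or leads to another permutation.
  -- In both cases some window is missed, so its `fiberWeight` vanishes.
  ∑-fiber : ∑ (fiber k σ) (λ p → q^ area k p) ≡ ∑ (allPreferences n) fiberWeight
  ∑-fiber = trans (sym (∑-if (λ p → φ k p ≈? σ) (λ p → q^ area k p) (allPF n k)))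
    (trans (∑-mapMaybe (λ α → Maybe.map (α ,_) (dec⇒maybe (isNaples? k α))) term (allPreferences n))
           (∑-cong (allPreferences n) λ α → term≡fiberWeight α (isNaples? k α)))
    where
    term : PF n k → Laurent
    term p = if does (φ k p ≈? σ) then q^ area k p else 0ᴸ

    term≡fiberWeight : ∀ α (naples? : Dec (IsNaples k α)) →
      maybe′ term 0ᴸ (Maybe.map (α ,_) (dec⇒maybe naples?)) ≡ fiberWeight α
    term≡fiberWeight α (no ¬naples) = sym (∏-weight-zero α (¬naples ∘ windows⇒naples α))
    term≡fiberWeight α (yes naples)
      with if-cases (φ k (α , naples) ≈? σ) (q^ area k (α , naples)) 0ᴸ
    ... | inj₁ (φ≈σ , eq) = trans eq (trans
            (cong q^_ (area-exponent (α , naples) φ≈σ))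
            (sym (∏-weight-windows α (φ≈⇒windows (α , naples) φ≈σ))))
    ... | inj₂ (φ≉σ , eq) = trans eq (sym (∏-weight-zero α (φ≉σ ∘ windows⇒φ≈ (α , naples))))

proposition5p8 : (n k : ℕ) → 1 ≤ n → k ≤ n ∸ 1 → (σ : Permutation′ n) →
    ∑ (fiber k σ) (λ p → q^ (area k p)) ≋ ∏ (λ i → [ ℓ k σ i ]q)
proposition5p8 n k _ _ σ = ↭⇒≋ (begin
  ∑ (fiber k σ) (λ p → q^ area k p)
    ≡⟨ ∑-fiber k σ ⟩
  ∑ (allPreferences n) (fiberWeight k σ)
    ↭⟨ ∑-∏ (allFin n) n (λ c → weight k σ (σ ⟨$⟩ˡ c)) ⟩
  ∏ (λ c → ∑ (allFin n) (weight k σ (σ ⟨$⟩ˡ c)))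
    -- The expansion gave one factor per car; `σ` turns this into one factor per spot.
    ↭⟨ ∏-permute (λ i → ∑ (allFin n) (weight k σ i)) (Perm.flip σ) ⟨
  ∏ (λ i → ∑ (allFin n) (weight k σ i))
    ↭⟨ ∏-cong (∑-weight k σ) ⟩
  ∏ (λ i → [ ℓ k σ i ]q) ∎)
  where open PermutationReasoning
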